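{- Let $k\ge 2$ and let $m_1,\dots,m_k\ge 2$ be integers satisfying $\sum_{i=1}^k 1/m_i<1$. Then $$C_k\le \prod_{i=1}^k m_i+\sum_{i=1}^k m_i,$$ and $$\mathrm{HGP}(B_{k,n})\le \prod_{i=1}^k m_i+\sum_{i=1}^k m_i\qquad\text{for every } n\ge 1 .$$
   Context: Proper hat-guessing game: let $G=(V,E)$ be a finite simple graph and $[q]=\{0,1,\dots,q-1\}$. Before play, the vertices agree on deterministic guess functions; the guess of each vertex is a function of the colors on its open neighborhood, with values in $[q]$. An adversary assigns a color from $[q]$ to every vertex so that adjacent vertices get distinct colors (a proper $q$-coloring). All vertices simultaneously guess their own colors. A strategy (family of guess functions) is winning with $q$ colors if for every proper $q$-coloring at least one vertex guesses its own color correctly. The proper hat-guessing number $\mathrm{HGP}(G)$ is the largest $q$ for which a winning strategy exists. The book graph is $B_{k,n}=K_k\vee\overline{K_n}$ (join): $k$ mutually adjacent vertices (spines) and $n$ pairwise nonadjacent vertices (pages), every page adjacent to every spine. A proper $k$-tuple is a $k$-tuple $\boldsymbol{x}=(x_1,\dots,x_k)$ of pairwise distinct colors; a configuration is a set $P$ of proper $k$-tuples, with colors drawn from some finite set. Let $\pi_i(\boldsymbol{x})$ be the $(k-1)$-tuple obtained by deleting coordinate $i$. A set $A$ of proper $k$-tuples is $i$-saturated if $\pi_i$ restricted to $A$ is injective. A configuration $P$ is coverable if it can be partitioned as $P=P_1\,\dot\cup\cdots\dot\cup\,P_k$ (parts may be empty) with $P_i$ being $i$-saturated for every $i$. Let $\mathrm{supp}(P)=\bigcup_{\boldsymbol{x}\in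 P}\{x_1,\dots,x_k\}$. Define $$C_k=\min\{|P|+|\mathrm{supp}(P)| : P \text{ is a finite non-coverable configuration of proper } k\text{ -tuples}\},$$ where the colors may be drawn from any finite set. -}

module Defs where

open import Data.Bool using (Bool; true; false; not; T)
open import Data.Fin using (Fin; splitAt; _≟_)
open import Data.Fin.Subset using (Subset; ⁅_⁆; ⋃; ∣_∣)
open import Data.Integer using (+_)
open import Data.List using (List; length; map; foldr; tabulate)
open import Data.List.Membership.Propositional using (_∈_)
open import Data.List.Relation.Binary.Subset.Propositional using (_⊆_)
open import Data.List.Relation.Unary.All using (All)
open import Data.List.Relation.Unary.Unique.Propositional using (Unique)
open import Data.Nat using (ℕ; suc; pred; _+_; _≤_; z≤n; s≤s; >-nonZero)
open import Data.Nat.Properties using (≤-trans)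
open import Data.Product using (_×_; ∃; ∃!; ∃-syntax)
open import Data.Rational as ℚ using (ℚ; 0ℚ)
open import Data.Sum using (_⊎_; inj₁; inj₂)
open import Data.Vec as Vec using (Vec; removeAt)
import Data.Vec.Relation.Unary.Unique.Propositional as VecUnique
open import Relation.Binary.PropositionalEquality using (_≡_; _≢_; refl; sym)
open import Relation.Nullary using (¬_; yes; no; contradiction)
open import Relation.Nullary.Decidable using (⌊_⌋)

record Graph : Set where
  field
    order       : ℕ
    adj         : Fin order → Fin order → Bool
    symmetric   : ∀ u v → adj u v ≡ adj v u
    irreflexive : ∀ v → adj v v ≡ false

  Vertex : Set
  Vertex = Fin order

  Adj : Vertex → Vertex → Set
  Adj u v = T (adj u v)

complete : ℕ → Graph
complete n = record
  { order       = n
  ; adj         = λ u v → not ⌊ u ≟ v ⌋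
  ; symmetric   = symm
  ; irreflexive = irr
  }
  where
  symm : (u v : Fin n) → not ⌊ u ≟ v ⌋ ≡ not ⌊ v ≟ u ⌋
  symm u v with u ≟ v | v ≟ u
  ... | yes _  | yes _  = refl
  ... | no _   | no _   = refl
  ... | yes eq | no neq = contradiction (sym eq) neq
  ... | no neq | yes eq = contradiction (sym eq) neq

  irr : (v : Fin n) → not ⌊ v ≟ v ⌋ ≡ false
  irr v with v ≟ v
  ... | yes _  = refl
  ... | no neq = contradiction refl neq

edgeless : ℕ → Graph
edgeless n = record
  { order       = n
  ; adj         = λ _ _ → false
  ; symmetric   = λ _ _ → refl
  ; irreflexive = λ _ → refl
  }

join : Graph → Graph → Graph
join G H = record
  { order       = G.order + H.order
  ; adj         = λ u v → adj⊎ (splitAt G.order u) (splitAt G.order v)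
  ; symmetric   = λ u v → symm (splitAt G.order u) (splitAt G.order v)
  ; irreflexive = λ v → irr (splitAt G.order v)
  }
  where
  module G = Graph G
  module H = Graph H

  adj⊎ : G.Vertex ⊎ H.Vertex → G.Vertex ⊎ H.Vertex → Bool
  adj⊎ (inj₁ u) (inj₁ v) = G.adj u v
  adj⊎ (inj₁ _) (inj₂ _) = true
  adj⊎ (inj₂ _) (inj₁ _) = true
  adj⊎ (inj₂ u) (inj₂ v) = H.adj u v

  symm : ∀ u v → adj⊎ u v ≡ adj⊎ v u
  symm (inj₁ u) (inj₁ v) = G.symmetric u v
  symm (inj₁ _) (inj₂ _) = refl
  symm (inj₂ _) (inj₁ _) = refl
  symm (inj₂ u) (inj₂ v) = H.symmetric u v

  irr : ∀ v → adj⊎ v v ≡ false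
  irr (inj₁ v) = G.irreflexive v
  irr (inj₂ v) = H.irreflexive v

book : ℕ → ℕ → Graph
book k n = join (complete k) (edgeless n)

module _ (G : Graph) where
  open Graph G

  ProperColoring : (q : ℕ) → (Vertex → Fin q) → Set
  ProperColoring q c = ∀ u v → Adj u v → c u ≢ c v

  NeighborhoodColoring : ℕ → Vertex → Set
  NeighborhoodColoring q v = ∀ u → Adj v u → Fin q

  -- Without function extensionality, being a function of the colors on the
  -- neighborhood has to be required as respect for pointwise equality.
  record Strategy (q : ℕ) : Set where
    field
      guess      : ∀ v → NeighborhoodColoring q v → Fin q
      guess-cong : ∀ v (x y : NeighborhoodColoring q v) →
                   (∀ u a → x u a ≡ y u a) → guess v x ≡ guess v y

  Winning : (q : ℕ) → Strategy q → Set
  Winning q S = ∀ c → ProperColoring q c →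
                ∃[ v ] Strategy.guess S v (λ u _ → c u) ≡ c v

  -- h is the largest q for which a winning strategy exists.
  IsHGP : ℕ → Set
  IsHGP h = ∃ (Winning h) × (∀ q → ∃ (Winning q) → q ≤ h)

Tuple : ℕ → ℕ → Set
Tuple r k = Vec (Fin r) k

Proper : ∀ {r k} → Tuple r k → Set
Proper = VecUnique.Unique

record Configuration (r k : ℕ) : Set where
  field
    tuples   : List (Tuple r k)
    distinct : Unique tuples
    proper   : All Proper tuples

π : ∀ {r k} → Fin k → Tuple r k → Tuple r (pred k)
π {k = suc _} i x = removeAt x i

Saturated : ∀ {r k} → Fin k → List (Tuple r k) → Set
Saturated i A = ∀ {x y} → x ∈ A → y ∈ A → π i x ≡ π i y → x ≡ y

-- Lists are read as sets here: repetitions within a part are immaterial.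
IsPartition : ∀ {r k} → List (Tuple r k) → (Fin k → List (Tuple r k)) → Set
IsPartition P parts = (∀ i → parts i ⊆ P) ×
                      (∀ {x} → x ∈ P → ∃! _≡_ (λ i → x ∈ parts i))

module _ {r k : ℕ} (P : Configuration r k) where
  open Configuration P

  Coverable : Set
  Coverable = ∃[ parts ] IsPartition tuples parts × (∀ i → Saturated i (parts i))

  card : ℕ
  card = length tuples

  supp : Subset r
  supp = ⋃ (map (λ x → ⋃ (map ⁅_⁆ (Vec.toList x))) tuples)

  cost : ℕ
  cost = card + ∣ supp ∣

-- c is the minimum of |P| + |supp P| over the non-coverable configurations P of
-- proper k-tuples; the number r of available colors is unrestricted.
IsC : ℕ → ℕ → Set
IsC k c =
  (∃[ r ] ∃[ P ] ¬ Coverable {r} {k} P × cost P ≡ c) ×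
  (∀ r (P : Configuration r k) → ¬ Coverable P → c ≤ cost P)

reciprocal : (n : ℕ) → 2 ≤ n → ℚ
reciprocal n n≥2 = ℚ._/_ (+ 1) n {{>-nonZero (≤-trans (s≤s z≤n) n≥2)}}

sumOfReciprocals : ∀ {k} (m : Fin k → ℕ) → (∀ i → 2 ≤ m i) → ℚ
sumOfReciprocals m m≥2 = foldr ℚ._+_ 0ℚ (tabulate (λ i → reciprocal (m i) (m≥2 i)))

{-# OPTIONS --safe #-}

-- A product A₁ × ⋯ × A_k of disjoint color sets with |A_i| = m_i is not
-- coverable: an i-saturated subset has at most ∏ m / m_i elements, and
-- ∑ 1/m_i < 1. Its cost is at most ∏ m + ∑ m.
--
-- A non-coverable P with cost(P) < q defeats every strategy on the book with q
-- colors. Relabel P into the q colors; each page p can then be given a color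
-- that is neither in supp P nor among its at most |P| guesses as the spine
-- tuple ranges over P. With those page colors fixed, winning would mean that
-- some spine guesses correctly on every tuple of P, and sorting P by a correct
-- spine would cover it.
--
-- The extrema exist constructively because relabelling confines the search to
-- finitely many configurations, and guess functions to finitely many tables.
module Submission where

open import Defs
open import Data.Fin using (Fin)
open import Data.List using (tabulate)
open import Data.Nat using (ℕ; _+_; _≤_)
open import Data.Nat.ListAction using (sum; product)
open import Data.Product using (_×_; ∃-syntax)
open import Data.Rational using (_<_; 1ℚ)

open import Data.Bool.Properties using (T?; T-irrelevant)
open import Data.Empty using (⊥-elim)
open import Data.Fin using (zero; suc; _↑ˡ_; _↑ʳ_; toℕ; fromℕ<; splitAt; punchOut; _≟_)
import Data.Fin.Properties as Finₚ
open import Data.Fin.Subset as Subset using (Subset; inside; outside; ⁅_⁆; ⋃; ∣_∣; _∪_)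
import Data.Fin.Subset.Properties as Subsetₚ
import Data.Integer as ℤ
import Data.Integer.Properties as ℤₚ
open import Data.List as List
  using (List; []; _∷_; length; map; filter; concat; allFin; upTo; cartesianProductWith)
import Data.List.Extrema.Nat as Extrema
open import Data.List.Membership.Propositional using (_∈_)
open import Data.List.Membership.Propositional.Properties as Listₘ
  using (∈-filter⁺; ∈-filter⁻; ∈-map⁺; ∈-map⁻; ∈-allFin; ∈-cartesianProductWith⁺;
         ∈-cartesianProductWith⁻)
import Data.List.Properties as Listₚ
open import Data.List.Relation.Unary.All as All using (All; []; _∷_)
import Data.List.Relation.Unary.All.Properties as Allₚ
open import Data.List.Relation.Unary.AllPairs using ([]; _∷_)
open import Data.List.Relation.Unary.Any as Any using (Any; here; there; index)
import Data.List.Relation.Unary.Any.Properties as Anyₚ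
import Data.List.Relation.Unary.Unique.DecPropositional as DecUnique
open import Data.List.Relation.Unary.Unique.Propositional using (Unique)
import Data.List.Relation.Unary.Unique.Propositional.Properties as Uniqueₚ
open import Data.Nat as ℕ using (zero; suc; pred; _*_; NonZero; z≤n; s≤s)
import Data.Nat.DivMod as DivMod
import Data.Nat.Properties as ℕₚ
open import Data.Product using (∃; _,_; proj₁; proj₂)
import Data.Rational as ℚ
import Data.Rational.Properties as ℚₚ
import Data.Rational.Unnormalised as ℚᵘ
import Data.Rational.Unnormalised.Properties as ℚᵘₚ
open import Data.Sum using (inj₁; inj₂; [_,_]′)
open import Data.Vec as Vec using (Vec; []; _∷_; removeAt; insertAt; lookup)
import Data.Vec.Properties as Vecₚ
import Data.Vec.Membership.Propositional.Properties as Vecₘ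
import Data.Vec.Relation.Unary.All as VecAll
import Data.Vec.Relation.Unary.All.Properties as VecAllₚ
import Data.Vec.Relation.Unary.AllPairs as VecPairs
import Data.Vec.Relation.Unary.Any as VecAny
import Data.Vec.Relation.Unary.Any.Properties as VecAnyₚ
import Data.Vec.Relation.Unary.Unique.Propositional.Properties as VecUniqueₚ
open import Function using (_∘_; case_of_; Injective)
open import Relation.Binary.PropositionalEquality
  using (_≡_; _≢_; _≗_; refl; sym; trans; cong; cong₂; subst)
open import Relation.Nullary using (¬_; Dec; yes; no; contradiction)
open import Relation.Nullary.Decidable using (map′; _×-dec_; _→-dec_; ¬?)
open import Relation.Unary using (Decidable)

-- Counting in lists

lookup-injective : ∀ {A : Set} {xs : List A} → Unique xs →
                   Injective _≡_ _≡_ (List.lookup xs)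
lookup-injective (_   ∷ _) {zero}  {zero}  _  = refl
lookup-injective (x∉  ∷ _) {zero}  {suc j} eq = contradiction eq (All.lookup x∉ (Listₘ.∈-lookup j))
lookup-injective (x∉  ∷ _) {suc i} {zero}  eq = contradiction (sym eq) (All.lookup x∉ (Listₘ.∈-lookup i))
lookup-injective (_  ∷ u)  {suc i} {suc j} eq = cong suc (lookup-injective u eq)

InjectiveOn : ∀ {A B : Set} → List A → (A → B) → Set
InjectiveOn xs f = ∀ {x y} → x ∈ xs → y ∈ xs → f x ≡ f y → x ≡ y

-- Pigeonhole: sending a position in `xs` to the position of its image in `ys` is injective, because
-- `xs` has no repetitions and `f` identifies none of its entries.
length-injectiveOn : ∀ {A B : Set} {xs : List A} {ys : List B} {f : A → B} →
                     Unique xs → InjectiveOn xs f → (∀ {x} → x ∈ xs → f x ∈ ys) →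
                     length xs ≤ length ys
length-injectiveOn {xs = xs} {ys} {f} u inj into = Finₚ.injective⇒≤ {f = position} position-injective
  where
  position : Fin (length xs) → Fin (length ys)
  position i = index (into (Listₘ.∈-lookup i))

  position-injective : Injective _≡_ _≡_ position
  position-injective {i} {j} eq = lookup-injective u
    (inj (Listₘ.∈-lookup i) (Listₘ.∈-lookup j)
      (trans (Anyₚ.lookup-index (into (Listₘ.∈-lookup i)))
        (trans (cong (List.lookup ys) eq) (sym (Anyₚ.lookup-index (into (Listₘ.∈-lookup j)))))))

map-unique : ∀ {A B : Set} {xs : List A} {f : A → B} → Unique xs → InjectiveOn xs f →
             Unique (map f xs)
map-unique []       inj = []
map-unique (x∉ ∷ u) inj =
  Allₚ.map⁺ (All.tabulate λ y∈ eq → All.lookup x∉ y∈ (inj (here refl) (there y∈) eq)) ∷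
  map-unique u (λ x∈ y∈ → inj (there x∈) (there y∈))

length-cartesianProductWith : ∀ {A B C : Set} (f : A → B → C) xs ys →
                              length (cartesianProductWith f xs ys) ≡ length xs * length ys
length-cartesianProductWith f []       ys = refl
length-cartesianProductWith f (x ∷ xs) ys =
  trans (Listₚ.length-++ (map (f x) ys))
    (cong₂ _+_ (Listₚ.length-map (f x) ys) (length-cartesianProductWith f xs ys))

length-concat-tabulate : ∀ {A : Set} k (F : Fin k → List A) →
                         length (concat (tabulate F)) ≡ sum (tabulate (length ∘ F))
length-concat-tabulate zero    F = refl
length-concat-tabulate (suc k) F =
  trans (Listₚ.length-++ (F zero)) (cong (length (F zero) +_) (length-concat-tabulate k (F ∘ suc)))

fibre : ∀ {A : Set} {k} → (A → Fin k) → List A → Fin k → List A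
fibre g xs i = filter (λ x → g x ≟ i) xs

-- Each `x` lies in the fibre over `g x`, so `xs` embeds in the concatenation of all fibres.
length≤sum-fibres : ∀ {A : Set} {k} (g : A → Fin k) {xs : List A} → Unique xs →
                    length xs ≤ sum (tabulate (length ∘ fibre g xs))
length≤sum-fibres g {xs} u =
  subst (length xs ≤_) (length-concat-tabulate _ (fibre g xs))
    (length-injectiveOn {f = λ x → x} u (λ _ _ eq → eq)
      (λ {x} x∈ → Listₘ.∈-concat⁺′ (∈-filter⁺ (λ y → g y ≟ g x) x∈ refl) (Listₘ.∈-tabulate⁺ (g x))))

-- Finite subsets

∣p∪q∣≤∣p∣+∣q∣ : ∀ {n} (p q : Subset n) → ∣ p ∪ q ∣ ≤ ∣ p ∣ + ∣ q ∣
∣p∪q∣≤∣p∣+∣q∣ []            []            = z≤n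
∣p∪q∣≤∣p∣+∣q∣ (outside ∷ p) (outside ∷ q) = ∣p∪q∣≤∣p∣+∣q∣ p q
∣p∪q∣≤∣p∣+∣q∣ (outside ∷ p) (inside  ∷ q) =
  subst (suc ∣ p ∪ q ∣ ≤_) (sym (ℕₚ.+-suc ∣ p ∣ ∣ q ∣)) (s≤s (∣p∪q∣≤∣p∣+∣q∣ p q))
∣p∪q∣≤∣p∣+∣q∣ (inside  ∷ p) (outside ∷ q) = s≤s (∣p∪q∣≤∣p∣+∣q∣ p q)
∣p∪q∣≤∣p∣+∣q∣ (inside  ∷ p) (inside  ∷ q) =
  s≤s (ℕₚ.≤-trans (∣p∪q∣≤∣p∣+∣q∣ p q) (ℕₚ.+-monoʳ-≤ ∣ p ∣ (ℕₚ.n≤1+n _)))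

x∈⋃⁺ : ∀ {n} {x : Fin n} {p ps} → p ∈ ps → x Subset.∈ p → x Subset.∈ ⋃ ps
x∈⋃⁺ (here refl) x∈ = Subsetₚ.x∈p∪q⁺ (inj₁ x∈)
x∈⋃⁺ (there p∈)  x∈ = Subsetₚ.x∈p∪q⁺ (inj₂ (x∈⋃⁺ p∈ x∈))

x∈⋃⁻ : ∀ {n} {x : Fin n} ps → x Subset.∈ ⋃ ps → ∃[ p ] p ∈ ps × x Subset.∈ p
x∈⋃⁻ []       x∈ = ⊥-elim (Subsetₚ.∉⊥ x∈)
x∈⋃⁻ (p ∷ ps) x∈ with Subsetₚ.x∈p∪q⁻ p (⋃ ps) x∈
... | inj₁ x∈p = p , here refl , x∈p
... | inj₂ x∈⋃ with p′ , p′∈ , x∈p′ ← x∈⋃⁻ ps x∈⋃ = p′ , there p′∈ , x∈p′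

image : ∀ {A : Set} {n} → (A → Fin n) → List A → Subset n
image f xs = ⋃ (map (⁅_⁆ ∘ f) xs)

∈-image⁺ : ∀ {A : Set} {n} (f : A → Fin n) {x xs} → x ∈ xs → f x Subset.∈ image f xs
∈-image⁺ f x∈ = x∈⋃⁺ (∈-map⁺ (⁅_⁆ ∘ f) x∈) (Subsetₚ.x∈⁅x⁆ _)

∣image∣≤length : ∀ {A : Set} {n} (f : A → Fin n) xs → ∣ image f xs ∣ ≤ length xs
∣image∣≤length {n = n} f []       = ℕₚ.≤-reflexive (Subsetₚ.∣⊥∣≡0 n)
∣image∣≤length f (x ∷ xs) =
  ℕₚ.≤-trans (∣p∪q∣≤∣p∣+∣q∣ ⁅ f x ⁆ (image f xs))
    (ℕₚ.+-mono-≤ (ℕₚ.≤-reflexive (Subsetₚ.∣⁅x⁆∣≡1 (f x))) (∣image∣≤length f xs))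

∣p∣<n⇒∃∉ : ∀ {n} (p : Subset n) → ∣ p ∣ ℕ.< n → ∃[ x ] ¬ (x Subset.∈ p)
∣p∣<n⇒∃∉ {n} p p<n = Finₚ.¬∀⟶∃¬ n _ (Subsetₚ._∈? p) λ all →
  ℕₚ.<⇒≱ p<n (subst (_≤ ∣ p ∣) (Subsetₚ.∣⊤∣≡n n) (Subsetₚ.p⊆q⇒∣p∣≤∣q∣ {p = Subset.⊤} {q = p} (λ {x} _ → all x)))

bounded⇒∣p∣≤ : ∀ {n} (p : Subset n) b → (∀ {x} → x Subset.∈ p → toℕ x ℕ.< b) → ∣ p ∣ ≤ b
bounded⇒∣p∣≤ []            b       bd = z≤n
bounded⇒∣p∣≤ (inside  ∷ p) zero    bd = contradiction (bd Vec.here) (λ ())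
bounded⇒∣p∣≤ (inside  ∷ p) (suc b) bd = s≤s (bounded⇒∣p∣≤ p b (λ x∈ → ℕ.s<s⁻¹ (bd (Vec.there x∈))))
bounded⇒∣p∣≤ (outside ∷ p) b       bd =
  bounded⇒∣p∣≤ p b (λ x∈ → ℕₚ.≤-trans (ℕₚ.n≤1+n _) (bd (Vec.there x∈)))

-- Counts the elements of the subset strictly below the given one; on the subset itself this is the
-- order isomorphism onto an initial segment of ℕ.
rank : ∀ {n} → Subset n → Fin n → ℕ
rank (_       ∷ p) zero    = 0
rank (inside  ∷ p) (suc x) = suc (rank p x)
rank (outside ∷ p) (suc x) = rank p x

rank<∣p∣ : ∀ {n} {p : Subset n} {x} → x Subset.∈ p → rank p x ℕ.< ∣ p ∣
rank<∣p∣ {p = inside  ∷ p} Vec.here       = s≤s z≤n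
rank<∣p∣ {p = inside  ∷ p} (Vec.there x∈) = s≤s (rank<∣p∣ x∈)
rank<∣p∣ {p = outside ∷ p} (Vec.there x∈) = rank<∣p∣ x∈

rank-injective : ∀ {n} {p : Subset n} {x y} → x Subset.∈ p → y Subset.∈ p →
                 rank p x ≡ rank p y → x ≡ y
rank-injective {p = inside  ∷ p} Vec.here       Vec.here       _  = refl
rank-injective {p = inside  ∷ p} (Vec.there x∈) (Vec.there y∈) eq =
  cong suc (rank-injective x∈ y∈ (ℕₚ.suc-injective eq))
rank-injective {p = outside ∷ p} (Vec.there x∈) (Vec.there y∈) eq = cong suc (rank-injective x∈ y∈ eq)

-- The remainder makes the relabelling a total map, defined also on colors outside `p`.
rankIn : ∀ {n} q .{{_ : NonZero q}} → Subset n → Fin n → Fin q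
rankIn q p x = fromℕ< (DivMod.m%n<n (rank p x) q)

-- Without the bound on p the remainder would identify ranks differing by q.
toℕ-rankIn : ∀ {n} q .{{_ : NonZero q}} (p : Subset n) {x} → ∣ p ∣ ≤ q → x Subset.∈ p →
             toℕ (rankIn q p x) ≡ rank p x
toℕ-rankIn q p p≤q x∈ =
  trans (Finₚ.toℕ-fromℕ< (DivMod.m%n<n _ q)) (DivMod.m<n⇒m%n≡m (ℕₚ.<-≤-trans (rank<∣p∣ x∈) p≤q))

-- Exhaustive search

-- The relation is a parameter because functions and strategies can be listed only up to pointwise
-- equality.
Exhausts : ∀ {F : Set} → List F → (F → F → Set) → Set
Exhausts fs _~_ = ∀ f → Any (f ~_) fs

∃? : ∀ {F : Set} {fs} {_~_ : F → F → Set} → Exhausts fs _~_ →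
     {P : F → Set} → (∀ {f h} → f ~ h → P f → P h) → Decidable P → Dec (∃ P)
∃? {fs = fs} exh resp P? = map′ Any.satisfied
  (λ (f , pf) → Any.map (λ f~h → resp f~h pf) (exh f)) (Any.any? P? fs)

-- Here the property travels from the listed representative back to `f`, opposite to the direction
-- in `∃?`.
∀? : ∀ {F : Set} {fs} {_~_ : F → F → Set} → Exhausts fs _~_ →
     {P : F → Set} → (∀ {f h} → f ~ h → P h → P f) → Decidable P → Dec (∀ f → P f)
∀? {fs = fs} exh {P} resp P? = map′
  (λ all f → All.lookupWith {R = λ _ → P f} (λ ph f~h → resp f~h ph) all (exh f))
  (λ p → All.tabulate (λ {h} _ → p h)) (All.all? P? fs)

vectors : ∀ {A : Set} → List A → ∀ n → List (Vec A n)
vectors xs zero    = [] ∷ []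
vectors xs (suc n) = cartesianProductWith _∷_ xs (vectors xs n)

vectors-exhaust : ∀ {A : Set} {xs : List A} → Exhausts xs _≡_ → ∀ n → Exhausts (vectors xs n) _≡_
vectors-exhaust exh zero    []       = here refl
vectors-exhaust exh (suc n) (x ∷ v) = ∈-cartesianProductWith⁺ _∷_ (exh x) (vectors-exhaust exh n v)

listsUpTo : ∀ {A : Set} → List A → ℕ → List (List A)
listsUpTo xs zero    = [] ∷ []
listsUpTo xs (suc n) = [] ∷ cartesianProductWith _∷_ xs (listsUpTo xs n)

∈-listsUpTo : ∀ {A : Set} {xs : List A} → Exhausts xs _≡_ → ∀ {n} l → length l ≤ n →
              l ∈ listsUpTo xs n
∈-listsUpTo exh {zero}  []      _         = here refl
∈-listsUpTo exh {suc n} []      _         = here refl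
∈-listsUpTo exh {suc n} (x ∷ l) (s≤s len) =
  there (∈-cartesianProductWith⁺ _∷_ (exh x) (∈-listsUpTo exh l len))

-- A function is encoded by its vector of values along `xs`; `exh a` selects one position of `a`, so
-- repetitions in `xs` do no harm.
functions : ∀ {A B : Set} {xs : List A} → Exhausts xs _≡_ → List B → List (A → B)
functions {xs = xs} exh ys = map (λ v a → lookup v (index (exh a))) (vectors ys (length xs))

functions-exhaust : ∀ {A B : Set} {xs : List A} (exh : Exhausts xs _≡_) {ys : List B} →
                    Exhausts ys _≡_ → Exhausts (functions exh ys) _≗_
functions-exhaust {xs = xs} exh exh′ f = Anyₚ.map⁺
  (Any.map (λ { refl a → trans (cong f (Anyₚ.lookup-index (exh a)))
                               (sym (Vecₚ.lookup∘tabulate _ (index (exh a)))) })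
    (vectors-exhaust exh′ _ (Vec.tabulate (f ∘ List.lookup xs))))

-- Coverability

Separates : ∀ {r k} → (Tuple r k → Fin k) → Tuple r k → Tuple r k → Set
Separates g x y = g x ≡ g y → π (g x) x ≡ π (g x) y → x ≡ y

-- A partition into saturated parts, given by the part each tuple belongs to; a
-- function on all tuples is easier to enumerate than a family of lists.
Labelling : ∀ {r k} → List (Tuple r k) → (Tuple r k → Fin k) → Set
Labelling L g = All (λ x → All (Separates g x) L) L

Labellable : ∀ {r k} → List (Tuple r k) → Set
Labellable L = ∃ (Labelling L)

labelling : ∀ {r k} {L : List (Tuple r k)} {g} →
            (∀ {x y} → x ∈ L → y ∈ L → Separates g x y) → Labelling L g
labelling sep = All.tabulate λ x∈ → All.tabulate λ y∈ → sep x∈ y∈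

separates : ∀ {r k} {L : List (Tuple r k)} {g x y} → Labelling L g → x ∈ L → y ∈ L → Separates g x y
separates lab x∈ y∈ = All.lookup (All.lookup lab x∈) y∈

_≟ᵗ_ : ∀ {r k} (x y : Tuple r k) → Dec (x ≡ y)
_≟ᵗ_ = Vecₚ.≡-dec _≟_

module _ {r k : ℕ} where
  open import Data.List.Membership.DecPropositional (_≟ᵗ_ {r} {suc k}) using (_∈?_)

  coverable⇒labellable : (P : Configuration r (suc k)) → Coverable P →
                         Labellable (Configuration.tuples P)
  coverable⇒labellable P (parts , (_ , part) , sat) = g , labelling sep
    where
    L = Configuration.tuples P

    g : Tuple r (suc k) → Fin (suc k)
    g x with x ∈? L
    ... | yes x∈ = proj₁ (part x∈)
    -- An arbitrary label off the configuration; it exists because the tuples have length `suc k`.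
    ... | no  _  = zero

    g-part : ∀ {x} → x ∈ L → x ∈ parts (g x)
    g-part {x} x∈ with x ∈? L
    ... | yes x∈′ = proj₁ (proj₂ (part x∈′))
    ... | no  x∉  = contradiction x∈ x∉

    sep : ∀ {x y} → x ∈ L → y ∈ L → Separates g x y
    sep {x} {y} x∈ y∈ gx≡gy eq =
      sat (g x) (g-part x∈) (subst (λ i → y ∈ parts i) (sym gx≡gy) (g-part y∈)) eq

labellable⇒coverable : ∀ {r k} (P : Configuration r k) → Labellable (Configuration.tuples P) →
                       Coverable P
labellable⇒coverable P (g , lab) =
  fibre g L ,
  ((λ i x∈ → proj₁ (∈-filter⁻ (λ y → g y ≟ i) x∈)) ,
   λ {x} x∈ → g x , ∈-filter⁺ (λ y → g y ≟ g x) x∈ refl ,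
     λ {i} x∈i → proj₂ (∈-filter⁻ (λ y → g y ≟ i) {xs = L} x∈i)) ,
  λ i {x} {y} x∈i y∈i eq →
    let x∈ , gx = ∈-filter⁻ (λ z → g z ≟ i) {xs = L} x∈i
        y∈ , gy = ∈-filter⁻ (λ z → g z ≟ i) {xs = L} y∈i
    in separates lab x∈ y∈ (trans gx (sym gy)) (subst (λ j → π j x ≡ π j y) (sym gx) eq)
  where
  L = Configuration.tuples P

labelling-resp-≗ : ∀ {r k} {L : List (Tuple r k)} {g h} → g ≗ h → Labelling L g → Labelling L h
labelling-resp-≗ g≗h lab = labelling λ {x} {y} x∈ y∈ hx≡hy eq →
  separates lab x∈ y∈ (trans (g≗h x) (trans hx≡hy (sym (g≗h y))))
    (subst (λ i → π i x ≡ π i y) (sym (g≗h x)) eq)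

labellable? : ∀ {r k} (L : List (Tuple r k)) → Dec (Labellable L)
labellable? {r} {k} L =
  ∃? (functions-exhaust (vectors-exhaust {xs = allFin r} ∈-allFin k) ∈-allFin) labelling-resp-≗
    (λ g → All.all? (λ x → All.all? (λ y →
      (g x ≟ g y) →-dec ((Vecₚ.≡-dec _≟_ (π (g x) x) (π (g x) y)) →-dec (x ≟ᵗ y))) L) L)

-- Relabelling colors

colors : ∀ {r k} → Tuple r k → Subset r
colors x = ⋃ (map ⁅_⁆ (Vec.toList x))

support : ∀ {r k} → List (Tuple r k) → Subset r
support L = ⋃ (map colors L)

-- The `cost` of a configuration, read off its bare list; the two agree by computation.
weight : ∀ {r k} → List (Tuple r k) → ℕ
weight L = length L + ∣ support L ∣

∈-support⁺ : ∀ {r k} {L : List (Tuple r k)} {x} → x ∈ L → ∀ j → lookup x j Subset.∈ support L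
∈-support⁺ {x = x} x∈ j =
  x∈⋃⁺ (∈-map⁺ colors x∈)
    (x∈⋃⁺ (∈-map⁺ ⁅_⁆ (Vecₘ.∈-toList⁺ (Vecₘ.∈-lookup j x))) (Subsetₚ.x∈⁅x⁆ (lookup x j)))

∈-support⁻ : ∀ {r k} (L : List (Tuple r k)) {c} → c Subset.∈ support L →
             ∃[ x ] x ∈ L × ∃[ j ] c ≡ lookup x j
∈-support⁻ L c∈
  with _ , p∈ , c∈p ← x∈⋃⁻ (map colors L) c∈
  with x , x∈ , p≡ ← ∈-map⁻ colors p∈
  with _ , s∈ , c∈s ← x∈⋃⁻ (map ⁅_⁆ (Vec.toList x)) (subst (_ Subset.∈_) p≡ c∈p)
  with d , d∈ , refl ← ∈-map⁻ ⁅_⁆ s∈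
  with refl ← Subsetₚ.x∈⁅y⁆⇒x≡y d c∈s
  = x , x∈ , VecAny.index (Vecₘ.∈-toList⁻ d∈) , VecAnyₚ.lookup-index (Vecₘ.∈-toList⁻ d∈)

removeAt-map : ∀ {A B : Set} {n} (f : A → B) (v : Vec A (suc n)) i →
               removeAt (Vec.map f v) i ≡ Vec.map f (removeAt v i)
removeAt-map f (a ∷ v)       zero    = refl
removeAt-map f (a ∷ b ∷ v)   (suc i) = cong (f a ∷_) (removeAt-map f (b ∷ v) i)

π-map : ∀ {r q k} (f : Fin r → Fin q) (x : Tuple r k) i → π i (Vec.map f x) ≡ Vec.map f (π i x)
π-map {k = suc _} f x i = removeAt-map f x i

vec-ext : ∀ {A : Set} {n} {v w : Vec A n} → (∀ i → lookup v i ≡ lookup w i) → v ≡ w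
vec-ext {v = v} {w} eq =
  trans (sym (Vecₚ.tabulate∘lookup v)) (trans (Vecₚ.tabulate-cong eq) (Vecₚ.tabulate∘lookup w))

vec-map-injective : ∀ {A B : Set} {f : A → B} {n} {v w : Vec A n} →
                    (∀ i → f (lookup v i) ≡ f (lookup w i) → lookup v i ≡ lookup w i) →
                    Vec.map f v ≡ Vec.map f w → v ≡ w
vec-map-injective {f = f} {v = v} {w} inj eq = vec-ext λ i → inj i
  (trans (sym (Vecₚ.lookup-map i f v))
    (trans (cong (λ u → lookup u i) eq) (Vecₚ.lookup-map i f w)))

module Relabel {r k : ℕ} (q : ℕ) .{{_ : NonZero q}} (L : List (Tuple r k)) (L≤q : ∣ support L ∣ ≤ q) where

  color : Fin r → Fin q
  color = rankIn q (support L)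

  color-injective : ∀ {c d} → c Subset.∈ support L → d Subset.∈ support L → color c ≡ color d → c ≡ d
  color-injective c∈ d∈ eq = rank-injective c∈ d∈
    (trans (sym (toℕ-rankIn q (support L) L≤q c∈))
      (trans (cong toℕ eq) (toℕ-rankIn q (support L) L≤q d∈)))

  relabel : Tuple r k → Tuple q k
  relabel = Vec.map color

  relabelled : List (Tuple q k)
  relabelled = map relabel L

  relabel-injective : InjectiveOn L relabel
  relabel-injective x∈ y∈ =
    vec-map-injective λ i → color-injective (∈-support⁺ x∈ i) (∈-support⁺ y∈ i)

  relabelled-proper : All Proper L → All Proper relabelled
  relabelled-proper proper = Allₚ.map⁺ (All.tabulate λ {x} x∈ →
    -- Injectivity of `color` is available only on the support, so distinctness is checked
    -- coordinatewise on the tabulated form of the tuple.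
    subst Proper (trans (Vecₚ.tabulate-∘ color (lookup x)) (cong relabel (Vecₚ.tabulate∘lookup x)))
      (VecUniqueₚ.tabulate⁺ λ {i} {j} eq →
        VecUniqueₚ.lookup-injective (All.lookup proper x∈) i j
          (color-injective (∈-support⁺ x∈ i) (∈-support⁺ x∈ j) eq)))

  -- Every new color is the rank of an old one, hence below the size of the old support.
  relabelled-weight : weight relabelled ≤ weight L
  relabelled-weight = ℕₚ.+-mono-≤ (ℕₚ.≤-reflexive (Listₚ.length-map relabel L))
    (bounded⇒∣p∣≤ (support relabelled) _ λ c∈ → bound c∈)
    where
    bound : ∀ {c} → c Subset.∈ support relabelled → toℕ c ℕ.< ∣ support L ∣
    bound c∈
      with y , y∈ , j , refl ← ∈-support⁻ relabelled c∈
      with x , x∈ , refl ← ∈-map⁻ relabel y∈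
      rewrite Vecₚ.lookup-map j color x | toℕ-rankIn q (support L) L≤q (∈-support⁺ x∈ j)
      = rank<∣p∣ (∈-support⁺ x∈ j)

  -- Labels pull back along `relabel`, since deleting a coordinate commutes with recoloring and
  -- recoloring is injective on `L`.
  labellable-relabelled : Labellable relabelled → Labellable L
  labellable-relabelled (g , lab) = g ∘ relabel , labelling λ {x} {y} x∈ y∈ gx≡gy eq →
    relabel-injective x∈ y∈
      (separates lab (∈-map⁺ relabel x∈) (∈-map⁺ relabel y∈) gx≡gy
        (trans (π-map color x _) (trans (cong (Vec.map color) eq) (sym (π-map color y _)))))

-- Product configurations on disjoint color sets

-- The new color goes into the first `a` colors and the others are shifted past them, so the
-- coordinates draw on disjoint color blocks.
prepend : ∀ a {s k} → Fin a → Tuple s k → Tuple (a + s) (suc k)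
prepend a {s} c v = (c ↑ˡ s) ∷ Vec.map (a ↑ʳ_) v

box : ∀ {k} (m : Fin k → ℕ) → List (Tuple (sum (tabulate m)) k)
box {zero}  m = [] ∷ []
box {suc k} m = cartesianProductWith (prepend (m zero)) (allFin (m zero)) (box (m ∘ suc))

map-↑ʳ-injective : ∀ a {s k} {v w : Tuple s k} → Vec.map (a ↑ʳ_) v ≡ Vec.map (a ↑ʳ_) w → v ≡ w
map-↑ʳ-injective a = vec-map-injective λ i → Finₚ.↑ʳ-injective a _ _

box-unique : ∀ {k} (m : Fin k → ℕ) → Unique (box m)
box-unique {zero}  m = [] ∷ []
box-unique {suc k} m = Uniqueₚ.cartesianProductWith⁺ (prepend (m zero))
  (λ eq → Finₚ.↑ˡ-injective _ _ _ (Vecₚ.∷-injectiveˡ eq) ,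
          map-↑ʳ-injective (m zero) (Vecₚ.∷-injectiveʳ eq))
  (Uniqueₚ.allFin⁺ (m zero)) (box-unique (m ∘ suc))

prepend-proper : ∀ a {s k} c {v : Tuple s k} → Proper v → Proper (prepend a c v)
prepend-proper a {s} c {v} proper =
  VecAllₚ.map⁺ (VecAll.universal (λ d eq → ↑ˡ≢↑ʳ d eq) v) VecPairs.∷
  VecUniqueₚ.map⁺ (Finₚ.↑ʳ-injective a _ _) proper
  where
  ↑ˡ≢↑ʳ : ∀ d → c ↑ˡ s ≢ a ↑ʳ d
  ↑ˡ≢↑ʳ d eq = case trans (sym (Finₚ.splitAt-↑ˡ a c s))
                    (trans (cong (splitAt a) eq) (Finₚ.splitAt-↑ʳ a s d)) of λ ()

box-proper : ∀ {k} (m : Fin k → ℕ) → All Proper (box m)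
box-proper {zero}  m = VecPairs.[] ∷ []
box-proper {suc k} m = All.tabulate λ x∈ →
  case ∈-cartesianProductWith⁻ (prepend (m zero)) (allFin (m zero)) (box (m ∘ suc)) x∈ of λ
    { (c , v , _ , v∈ , refl) → prepend-proper (m zero) c (All.lookup (box-proper (m ∘ suc)) v∈) }

length-allFin : ∀ n → length (allFin n) ≡ n
length-allFin n = Listₚ.length-tabulate (λ x → x)

length-box : ∀ {k} (m : Fin k → ℕ) → length (box m) ≡ product (tabulate m)
length-box {zero}  m = refl
length-box {suc k} m =
  trans (length-cartesianProductWith (prepend (m zero)) (allFin (m zero)) (box (m ∘ suc)))
    (cong₂ _*_ (length-allFin (m zero)) (length-box (m ∘ suc)))

-- The image of box m under π i.
face : ∀ {k} (m : Fin k → ℕ) → Fin k → List (Tuple (sum (tabulate m)) (pred k))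
face {suc k}       m zero    = map (Vec.map (m zero ↑ʳ_)) (box (m ∘ suc))
face {suc (suc k)} m (suc i) =
  cartesianProductWith (prepend (m zero)) (allFin (m zero)) (face (m ∘ suc) i)

-- A face omits one factor of the product; the multiplied form avoids division.
length-face : ∀ {k} (m : Fin k → ℕ) i → length (face m i) * m i ≡ product (tabulate m)
length-face {suc k}       m zero    =
  trans (cong (_* m zero) (trans (Listₚ.length-map _ (box (m ∘ suc))) (length-box (m ∘ suc))))
    (ℕₚ.*-comm (product (tabulate (m ∘ suc))) (m zero))
length-face {suc (suc k)} m (suc i) =
  trans (cong (_* m (suc i))
      (trans (length-cartesianProductWith (prepend (m zero)) (allFin (m zero)) (face (m ∘ suc) i))
        (cong (_* length (face (m ∘ suc) i)) (length-allFin (m zero)))))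
    (trans (ℕₚ.*-assoc (m zero) _ _) (cong (m zero *_) (length-face (m ∘ suc) i)))

π-box : ∀ {k} (m : Fin k → ℕ) i {x} → x ∈ box m → π i x ∈ face m i
π-box {suc k} m i x∈
  with c , v , c∈ , v∈ , refl ←
       ∈-cartesianProductWith⁻ (prepend (m zero)) (allFin (m zero)) (box (m ∘ suc)) x∈
  = go m i c∈ v∈
  where
  go : ∀ {k} (m : Fin (suc k) → ℕ) i {c v} → c ∈ allFin (m zero) → v ∈ box (m ∘ suc) →
       π i (prepend (m zero) c v) ∈ face m i
  go m zero _ v∈ = ∈-map⁺ _ v∈
  go {suc k} m (suc i) {c} {v@(_ ∷ _)} c∈ v∈ =
    subst (_∈ face m (suc i)) (cong ((c ↑ˡ _) ∷_) (sym (removeAt-map (m zero ↑ʳ_) v i)))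
      (∈-cartesianProductWith⁺ (prepend (m zero)) c∈ (π-box (m ∘ suc) i v∈))

-- On the fibre over `i` the projection `π i` is injective with values in `face m i`, so the fibre
-- is no longer than the face.
labelling⇒fibre-small : ∀ {k} (m : Fin k → ℕ) {g} → Labelling (box m) g → ∀ i →
                        length (fibre g (box m) i) * m i ≤ product (tabulate m)
labelling⇒fibre-small m {g} lab i =
  subst (length (fibre g (box m) i) * m i ≤_) (length-face m i)
    (ℕₚ.*-monoˡ-≤ (m i) (length-injectiveOn (Uniqueₚ.filter⁺ (λ x → g x ≟ i) (box-unique m))
      (λ {x} {y} x∈i y∈i eq →
        let x∈ , gx = ∈-filter⁻ (λ z → g z ≟ i) {xs = box m} x∈i
            y∈ , gy = ∈-filter⁻ (λ z → g z ≟ i) {xs = box m} y∈i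
        in separates lab x∈ y∈ (trans gx (sym gy)) (subst (λ j → π j x ≡ π j y) (sym gx) eq))
      (λ x∈i → π-box m i (proj₁ (∈-filter⁻ (λ z → g z ≟ i) {xs = box m} x∈i)))))

-- Counting against the sum of reciprocals

fromℕ : ℕ → ℚ.ℚ
fromℕ n = (ℤ.+ n) ℚ./ 1

-- Unnormalised fractions are used because there the numerators and denominators compute without gcd
-- reduction.
fromℕ-+ : ∀ a b → fromℕ (a + b) ≡ fromℕ a ℚ.+ fromℕ b
fromℕ-+ a b = ℚₚ.toℚᵘ-injective (begin
  ℚ.toℚᵘ (fromℕ (a + b))                     ≈⟨ ℚₚ.toℚᵘ-fromℚᵘ (ℚᵘ.mkℚᵘ (ℤ.+ (a + b)) 0) ⟩
  ℚᵘ.mkℚᵘ (ℤ.+ (a + b)) 0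
    ≈⟨ ℚᵘ.*≡* (cong (ℤ._* ℤ.+ 1)
         (cong₂ ℤ._+_ (sym (ℤₚ.*-identityʳ (ℤ.+ a))) (sym (ℤₚ.*-identityʳ (ℤ.+ b))))) ⟩
  ℚᵘ.mkℚᵘ (ℤ.+ a) 0 ℚᵘ.+ ℚᵘ.mkℚᵘ (ℤ.+ b) 0
    ≈⟨ ℚᵘₚ.+-cong (ℚₚ.toℚᵘ-fromℚᵘ (ℚᵘ.mkℚᵘ (ℤ.+ a) 0)) (ℚₚ.toℚᵘ-fromℚᵘ (ℚᵘ.mkℚᵘ (ℤ.+ b) 0)) ⟨
  ℚ.toℚᵘ (fromℕ a) ℚᵘ.+ ℚ.toℚᵘ (fromℕ b)     ≈⟨ ℚₚ.toℚᵘ-homo-+ (fromℕ a) (fromℕ b) ⟨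
  ℚ.toℚᵘ (fromℕ a ℚ.+ fromℕ b)               ∎)
  where open ℚᵘₚ.≃-Reasoning

fromℕ-mono-≤ : ∀ {a b} → a ≤ b → fromℕ a ℚ.≤ fromℕ b
fromℕ-mono-≤ {a} {b} a≤b = ℚₚ.toℚᵘ-cancel-≤ (begin
  ℚ.toℚᵘ (fromℕ a)    ≃⟨ ℚₚ.toℚᵘ-fromℚᵘ (ℚᵘ.mkℚᵘ (ℤ.+ a) 0) ⟩
  ℚᵘ.mkℚᵘ (ℤ.+ a) 0   ≤⟨ ℚᵘ.*≤* (ℤₚ.*-monoʳ-≤-nonNeg (ℤ.+ 1) (ℤ.+≤+ a≤b)) ⟩
  ℚᵘ.mkℚᵘ (ℤ.+ b) 0   ≃⟨ ℚₚ.toℚᵘ-fromℚᵘ (ℚᵘ.mkℚᵘ (ℤ.+ b) 0) ⟨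
  ℚ.toℚᵘ (fromℕ b)    ∎)
  where open ℚᵘₚ.≤-Reasoning

fromℕ≤fromℕ*reciprocal : ∀ a m (m≥2 : 2 ≤ m) M → a * m ≤ M →
                         fromℕ a ℚ.≤ fromℕ M ℚ.* reciprocal m m≥2
fromℕ≤fromℕ*reciprocal a (suc m) m≥2 M am≤M = ℚₚ.toℚᵘ-cancel-≤ (begin
  ℚ.toℚᵘ (fromℕ a)                                       ≃⟨ ℚₚ.toℚᵘ-fromℚᵘ (ℚᵘ.mkℚᵘ (ℤ.+ a) 0) ⟩
  ℚᵘ.mkℚᵘ (ℤ.+ a) 0                                      ≤⟨ ℚᵘ.*≤* cross ⟩
  ℚᵘ.mkℚᵘ (ℤ.+ M) 0 ℚᵘ.* ℚᵘ.mkℚᵘ (ℤ.+ 1) m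
    ≃⟨ ℚᵘₚ.*-cong (ℚₚ.toℚᵘ-fromℚᵘ (ℚᵘ.mkℚᵘ (ℤ.+ M) 0)) (ℚₚ.toℚᵘ-fromℚᵘ (ℚᵘ.mkℚᵘ (ℤ.+ 1) m)) ⟨
  ℚ.toℚᵘ (fromℕ M) ℚᵘ.* ℚ.toℚᵘ (reciprocal (suc m) m≥2)  ≃⟨ ℚₚ.toℚᵘ-homo-* (fromℕ M) (reciprocal (suc m) m≥2) ⟨
  ℚ.toℚᵘ (fromℕ M ℚ.* reciprocal (suc m) m≥2)            ∎)
  where
  open ℚᵘₚ.≤-Reasoning

  -- The cross-multiplied inequality; `suc (m + 0)` is what the denominator `1 * suc m` of the
  -- product computes to.
  cross : ℤ.+ a ℤ.* ℤ.+ suc (m + 0) ℤ.≤ (ℤ.+ M ℤ.* ℤ.+ 1) ℤ.* ℤ.+ 1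
  cross rewrite ℕₚ.+-identityʳ m | ℤₚ.*-identityʳ (ℤ.+ M ℤ.* ℤ.+ 1) | ℤₚ.*-identityʳ (ℤ.+ M)
              | sym (ℤₚ.pos-* a (suc m)) = ℤ.+≤+ am≤M

sum≤*sumOfReciprocals : ∀ {k} (m : Fin k → ℕ) (m≥2 : ∀ i → 2 ≤ m i) (a : Fin k → ℕ) M →
                        (∀ i → a i * m i ≤ M) →
                        fromℕ (sum (tabulate a)) ℚ.≤ fromℕ M ℚ.* sumOfReciprocals m m≥2
sum≤*sumOfReciprocals {zero}  m m≥2 a M am≤M = ℚₚ.≤-reflexive (sym (ℚₚ.*-zeroʳ (fromℕ M)))
sum≤*sumOfReciprocals {suc k} m m≥2 a M am≤M = begin
  fromℕ (a zero + sum (tabulate (a ∘ suc)))          ≡⟨ fromℕ-+ (a zero) _ ⟩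
  fromℕ (a zero) ℚ.+ fromℕ (sum (tabulate (a ∘ suc)))
    ≤⟨ ℚₚ.+-mono-≤ (fromℕ≤fromℕ*reciprocal (a zero) (m zero) (m≥2 zero) M (am≤M zero))
                   (sum≤*sumOfReciprocals (m ∘ suc) (m≥2 ∘ suc) (a ∘ suc) M (am≤M ∘ suc)) ⟩
  fromℕ M ℚ.* reciprocal (m zero) (m≥2 zero) ℚ.+ fromℕ M ℚ.* sumOfReciprocals (m ∘ suc) (m≥2 ∘ suc)
    ≡⟨ ℚₚ.*-distribˡ-+ (fromℕ M) (reciprocal (m zero) (m≥2 zero)) _ ⟨
  fromℕ M ℚ.* sumOfReciprocals m m≥2                 ∎
  where open ℚₚ.≤-Reasoning

product-positive : ∀ {k} (m : Fin k → ℕ) → (∀ i → 2 ≤ m i) → 1 ≤ product (tabulate m)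
product-positive {zero}  m m≥2 = s≤s z≤n
product-positive {suc k} m m≥2 =
  ℕₚ.*-mono-≤ (ℕₚ.≤-trans (s≤s z≤n) (m≥2 zero)) (product-positive (m ∘ suc) (m≥2 ∘ suc))

box-notLabellable : ∀ {k} (m : Fin k → ℕ) (m≥2 : ∀ i → 2 ≤ m i) → sumOfReciprocals m m≥2 < 1ℚ →
                    ¬ Labellable (box m)
box-notLabellable m m≥2 S<1 (g , lab) = ℚₚ.<-irrefl refl (begin-strict
  fromℕ M                                  ≤⟨ fromℕ-mono-≤ M≤sum ⟩
  fromℕ (sum (tabulate sizes))             ≤⟨ sum≤*sumOfReciprocals m m≥2 sizes M (labelling⇒fibre-small m lab) ⟩
  fromℕ M ℚ.* sumOfReciprocals m m≥2       <⟨ ℚₚ.*-monoʳ-<-pos (fromℕ M) {{positive}} S<1 ⟩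
  fromℕ M ℚ.* 1ℚ                           ≡⟨ ℚₚ.*-identityʳ (fromℕ M) ⟩
  fromℕ M                                  ∎)
  where
  open ℚₚ.≤-Reasoning
  M     = product (tabulate m)
  sizes = length ∘ fibre g (box m)

  M≤sum : M ≤ sum (tabulate sizes)
  M≤sum = subst (_≤ sum (tabulate sizes)) (length-box m) (length≤sum-fibres g (box-unique m))

  -- Multiplying the strict hypothesis by `M` keeps it strict only for positive `M`.
  positive : ℚ.Positive (fromℕ M)
  positive = ℚ.positive (ℚₚ.<-≤-trans (ℚₚ.positive⁻¹ 1ℚ) (fromℕ-mono-≤ (product-positive m m≥2)))

-- The minimum weight

-- Non-coverable configurations in a form that can be decided and hence filtered out of a finite
-- list.
Obstruction : ∀ {r k} → List (Tuple r k) → Set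
Obstruction L = Unique L × All Proper L × ¬ Labellable L

obstruction? : ∀ {r k} (L : List (Tuple r k)) → Dec (Obstruction L)
obstruction? L =
  DecUnique.unique? _≟ᵗ_ L ×-dec All.all? (VecPairs.allPairs? λ c d → ¬? (c ≟ d)) L ×-dec
  ¬? (labellable? L)

obstruction-relabelled : ∀ {r k} q .{{_ : NonZero q}} (L : List (Tuple r k)) → Obstruction L →
                         weight L ≤ q → ∃[ L′ ] Obstruction {q} L′ × weight L′ ≤ weight L
obstruction-relabelled q L (unique , proper , ¬lab) w≤q =
  relabelled ,
  (map-unique unique relabel-injective , relabelled-proper proper , ¬lab ∘ labellable-relabelled) ,
  relabelled-weight
  where open Relabel q L (ℕₚ.≤-trans (ℕₚ.m≤n+m _ (length L)) w≤q)

obstruction⇒configuration : ∀ {r k} {L : List (Tuple r (suc k))} → Obstruction L →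
                            ∃[ P ] ¬ Coverable P × cost P ≡ weight L
obstruction⇒configuration {L = L} (unique , proper , ¬lab) = P , ¬lab ∘ coverable⇒labellable P , refl
  where
  P : Configuration _ _
  P = record { tuples = L ; distinct = unique ; proper = proper }

configuration⇒obstruction : ∀ {r k} (P : Configuration r k) → ¬ Coverable P →
                            Obstruction (Configuration.tuples P)
configuration⇒obstruction P ¬cov =
  Configuration.distinct P , Configuration.proper P , ¬cov ∘ labellable⇒coverable P

-- The one number `N` bounds both tuples and colors: an obstruction of weight at most `N` has at
-- most `N` tuples and, after relabelling, uses colors from `Fin N`.
module Minimum {k : ℕ} (N : ℕ) .{{_ : NonZero N}} (start : List (Tuple N (suc k)))
               (start-obstruction : Obstruction start) (start≤N : weight start ≤ N) where

  space : List (List (Tuple N (suc k)))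
  space = listsUpTo (vectors (allFin N) (suc k)) N

  least : List (Tuple N (suc k))
  least = Extrema.argmin weight start (filter obstruction? space)

  least-obstruction : Obstruction least
  least-obstruction =
    Extrema.argmin-all weight {xs = filter obstruction? space} {P = Obstruction}
      start-obstruction (Allₚ.all-filter obstruction? space)

  least≤start : weight least ≤ weight start
  least≤start = Extrema.f[argmin]≤f[⊤] {f = weight} start (filter obstruction? space)

  least≤ : ∀ L → Obstruction L → weight L ≤ N → weight least ≤ weight L
  least≤ L obs L≤N = All.lookup (Extrema.f[argmin]≤f[xs] {f = weight} start (filter obstruction? space))
    (∈-filter⁺ obstruction?
      (∈-listsUpTo (vectors-exhaust ∈-allFin (suc k)) L (ℕₚ.≤-trans (ℕₚ.m≤m+n _ _) L≤N)) obs)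

  minimal : ∀ {s} (L : List (Tuple s (suc k))) → Obstruction L → weight least ≤ weight L
  minimal L obs with weight L ℕ.≤? N
  -- A list too heavy for the search space is already heavier than `start`.
  ... | no  L≰N = ℕₚ.≤-trans least≤start (ℕₚ.≤-trans start≤N (ℕₚ.<⇒≤ (ℕₚ.≰⇒> L≰N)))
  ... | yes L≤N
    with L′ , obs′ , L′≤L ← obstruction-relabelled N L obs L≤N
    = ℕₚ.≤-trans (least≤ L′ obs′ (ℕₚ.≤-trans L′≤L L≤N)) L′≤L

  isC : IsC (suc k) (weight least)
  isC = (N , obstruction⇒configuration least-obstruction) ,
        λ s P ¬cov → minimal (Configuration.tuples P) (configuration⇒obstruction P ¬cov)

minimumWeight : ∀ {r k} N .{{_ : NonZero N}} (L : List (Tuple r (suc k))) → Obstruction L →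
                weight L ≤ N → ∃[ c ] IsC (suc k) c × c ≤ N
minimumWeight N L obs L≤N
  with L′ , obs′ , L′≤L ← obstruction-relabelled N L obs L≤N
  = weight M.least , M.isC , ℕₚ.≤-trans M.least≤start L′≤N
  where
  L′≤N = ℕₚ.≤-trans L′≤L L≤N
  module M = Minimum N L′ obs′ L′≤N

-- Deciding whether a game is winnable

module _ (G : Graph) (j : ℕ) where
  open Graph G

  private q = suc j

  SameGuesses : Strategy G q → Strategy G q → Set
  SameGuesses S S′ = ∀ v x → Strategy.guess S v x ≡ Strategy.guess S′ v x

  extendAt : ∀ v → NeighborhoodColoring G q v → Vertex → Fin q
  extendAt v x u with T? (adj v u)
  ... | yes a = x u a
  ... | no  _ = zero

  -- Colors off the neighborhood are set to zero, so that guesses can be read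
  -- off a table indexed by colorings of the whole vertex set.
  extend : ∀ v → NeighborhoodColoring G q v → Vec (Fin q) order
  extend v x = Vec.tabulate (extendAt v x)

  extendAt-cong : ∀ v {x y : NeighborhoodColoring G q v} → (∀ u a → x u a ≡ y u a) →
                  extendAt v x ≗ extendAt v y
  extendAt-cong v x≗y u with T? (adj v u)
  ... | yes a = x≗y u a
  ... | no  _ = refl

  extendAt-adj : ∀ v (x : NeighborhoodColoring G q v) u a → extendAt v x u ≡ x u a
  extendAt-adj v x u a with T? (adj v u)
  ... | yes b = cong (x u) (T-irrelevant b a)
  ... | no ¬a = contradiction a ¬a

  Table : Set
  Table = Vertex × Vec (Fin q) order → Fin q

  tableStrategy : Table → Strategy G q
  tableStrategy t = record
    { guess      = λ v x → t (v , extend v x)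
    ; guess-cong = λ v x y x≗y → cong (λ w → t (v , w)) (Vecₚ.tabulate-cong (extendAt-cong v x≗y))
    }

  toTable : Strategy G q → Table
  toTable S (v , c) = Strategy.guess S v (λ u _ → lookup c u)

  -- The extension agrees with `x` on the neighborhood, and `guess-cong` says that nothing else
  -- affects the guess.
  toTable-extend : ∀ S v x → Strategy.guess S v x ≡ toTable S (v , extend v x)
  toTable-extend S v x = Strategy.guess-cong S v _ _ λ u a →
    sym (trans (Vecₚ.lookup∘tabulate (extendAt v x) u) (extendAt-adj v x u a))

  entries : List (Vertex × Vec (Fin q) order)
  entries = List.cartesianProduct (allFin order) (vectors (allFin q) order)

  entries-exhaust : Exhausts entries _≡_
  entries-exhaust (v , c) =
    Listₘ.∈-cartesianProduct⁺ (∈-allFin v) (vectors-exhaust {xs = allFin q} ∈-allFin order c)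

  tables : List Table
  tables = functions entries-exhaust (allFin q)

  strategy-exhaust : Exhausts (map tableStrategy tables) SameGuesses
  strategy-exhaust S = Anyₚ.map⁺ (Any.map
    (λ S≗t v x → trans (toTable-extend S v x) (S≗t (v , extend v x)))
    (functions-exhaust entries-exhaust ∈-allFin (toTable S)))

  properColoring? : Decidable (ProperColoring G q)
  properColoring? c = Finₚ.all? λ u → Finₚ.all? λ v → T? (adj u v) →-dec ¬? (c u ≟ c v)

  properColoring-resp-≗ : ∀ {c d} → c ≗ d → ProperColoring G q c → ProperColoring G q d
  properColoring-resp-≗ c≗d proper u v a eq = proper u v a (trans (c≗d u) (trans eq (sym (c≗d v))))

  winning? : Decidable (Winning G q)
  winning? S = ∀? (functions-exhaust {xs = allFin order} ∈-allFin ∈-allFin)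
    -- Colorings are enumerated only pointwise, so `guess-cong` must carry the correct guess from
    -- `d` to `c`.
    (λ {c} {d} c≗d wins proper →
      let v , correct = wins (properColoring-resp-≗ c≗d proper)
      in v , trans (Strategy.guess-cong S v _ _ (λ u _ → c≗d u)) (trans correct (sym (c≗d v))))
    (λ c → properColoring? c →-dec
      Finₚ.any? λ v → Strategy.guess S v (λ u _ → c u) ≟ c v)

  winnable? : Dec (∃ (Winning G q))
  winnable? = ∃? {_~_ = SameGuesses} strategy-exhaust
    (λ S~S′ wins c proper → let v , correct = wins c proper in v , trans (sym (S~S′ v _)) correct)
    winning?

hgp-exists : ∀ G N → ∃ (Winning G 1) → (∀ q → ∃ (Winning G q) → q ≤ N) → ∃[ h ] IsHGP G h × h ≤ N
hgp-exists G N wins₁ bound = suc h , (winnable , maximal) , bound (suc h) winnable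
  where
  winnables = filter (winnable? G) (upTo N)
  -- Indices are shifted by one: `j` stands for `suc j` colors, and the default 0 is the one-color
  -- game won by `wins₁`.
  h = Extrema.max 0 winnables

  winnable : ∃ (Winning G (suc h))
  winnable = Extrema.argmax-all (λ j → j) {P = λ j → ∃ (Winning G (suc j))} {xs = winnables}
    wins₁ (Allₚ.all-filter (winnable? G) (upTo N))

  maximal : ∀ q → ∃ (Winning G q) → q ≤ suc h
  maximal zero    _    = z≤n
  maximal (suc j) wins = s≤s (All.lookup (Extrema.xs≤max 0 winnables)
    (∈-filter⁺ (winnable? G) (Listₘ.∈-upTo⁺ (bound (suc j) wins)) wins))

-- Book graphs

module _ (k n j : ℕ) where

  private
    q = suc j
    B = book (suc k) n

  bookColoring : Tuple q (suc k) → (Fin n → Fin q) → Fin (suc k + n) → Fin q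
  bookColoring x page u = [ lookup x , page ]′ (splitAt (suc k) u)

  bookColoring-proper : ∀ {x page} → Proper x → (∀ i p → lookup x i ≢ page p) →
                        ProperColoring B q (bookColoring x page)
  bookColoring-proper {x} proper fresh u v a eq with splitAt (suc k) u | splitAt (suc k) v
  ... | inj₁ i | inj₂ p = fresh i p eq
  ... | inj₂ p | inj₁ i = fresh i p (sym eq)
  ... | inj₁ i | inj₁ i′ with i ≟ i′
  ...   | no i≢i′ = i≢i′ (VecUniqueₚ.lookup-injective proper i i′ eq)

  -- A spine sees every other color, so its guess depends only on the tuple
  -- with its own color deleted.
  bookColoring-spine : ∀ {x y page} i → π i x ≡ π i y → ∀ u → Graph.Adj B (i ↑ˡ n) u →
                       bookColoring x page u ≡ bookColoring y page u
  bookColoring-spine {x} {y} i eq u a rewrite Finₚ.splitAt-↑ˡ (suc k) i n with splitAt (suc k) u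
  ... | inj₂ p = refl
  ... | inj₁ i′ with i ≟ i′
  ...   | no i≢i′ = trans (sym (Vecₚ.removeAt-punchOut x i≢i′))
                      (trans (cong (λ v → lookup v (punchOut i≢i′)) eq) (Vecₚ.removeAt-punchOut y i≢i′))

  -- A page sees only spines. Its guess is therefore known before any page is colored, which makes
  -- the later choice of page colors noncircular.
  bookColoring-page : ∀ {x page page′} p u → Graph.Adj B (suc k ↑ʳ p) u →
                      bookColoring x page u ≡ bookColoring x page′ u
  bookColoring-page p u a rewrite Finₚ.splitAt-↑ʳ (suc k) n p with splitAt (suc k) u
  ... | inj₁ i = refl

  π-lookup-injective : ∀ {x y : Tuple q (suc k)} i → π i x ≡ π i y → lookup x i ≡ lookup y i → x ≡ y
  π-lookup-injective {x} {y} i eq eqᵢ =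
    trans (sym (Vecₚ.insertAt-removeAt x i))
      (trans (cong₂ (λ v c → insertAt v i c) eq eqᵢ) (Vecₚ.insertAt-removeAt y i))

  module _ (S : Strategy B q) (wins : Winning B q S)
           (L : List (Tuple q (suc k))) (proper : All Proper L) (L<q : weight L ℕ.< q) where

    open Strategy S

    pageGuess : Fin n → Tuple q (suc k) → Fin q
    -- The constant page coloring is a placeholder that page `p` cannot see.
    pageGuess p x = guess (suc k ↑ʳ p) (λ u _ → bookColoring x (λ _ → zero) u)

    forbidden : Fin n → Subset q
    forbidden p = image (pageGuess p) L ∪ support L

    -- At most one guess per tuple and the support are excluded, altogether at most `weight L`
    -- colors, which is less than `q`.
    allowed : ∀ p → ∃[ c ] ¬ (c Subset.∈ forbidden p)
    allowed p = ∣p∣<n⇒∃∉ (forbidden p) (ℕₚ.≤-<-trans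
      (ℕₚ.≤-trans (∣p∪q∣≤∣p∣+∣q∣ (image (pageGuess p) L) (support L))
        (ℕₚ.+-monoˡ-≤ ∣ support L ∣ (∣image∣≤length (pageGuess p) L))) L<q)

    page : Fin n → Fin q
    page p = proj₁ (allowed p)

    fresh : ∀ {x} → x ∈ L → ∀ i p → lookup x i ≢ page p
    fresh x∈ i p eq = proj₂ (allowed p)
      (Subsetₚ.x∈p∪q⁺ (inj₂ (subst (Subset._∈ support L) eq (∈-support⁺ x∈ i))))

    pageGuess-wrong : ∀ {x} → x ∈ L → ∀ p →
                      guess (suc k ↑ʳ p) (λ u _ → bookColoring x page u) ≢ page p
    pageGuess-wrong {x} x∈ p eq = proj₂ (allowed p) (Subsetₚ.x∈p∪q⁺ (inj₁
      (subst (Subset._∈ image (pageGuess p) L)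
        (trans (guess-cong (suc k ↑ʳ p) _ _ (bookColoring-page {x} p)) eq)
        (∈-image⁺ (pageGuess p) x∈))))

    Correct : Tuple q (suc k) → Fin (suc k) → Set
    Correct x i = guess (i ↑ˡ n) (λ u _ → bookColoring x page u) ≡ lookup x i

    correct? : ∀ x → Decidable (Correct x)
    correct? x i = _ ≟ _

    someSpineCorrect : ∀ {x} → x ∈ L → ∃ (Correct x)
    someSpineCorrect {x} x∈
      with v , correct ← wins (bookColoring x page) (bookColoring-proper (All.lookup proper x∈) (fresh x∈))
      with splitAt (suc k) v in eq
    ... | inj₁ i with refl ← Finₚ.splitAt⁻¹-↑ˡ {suc k} {n} {v} {i} eq = i , correct
    ... | inj₂ p with refl ← Finₚ.splitAt⁻¹-↑ʳ {suc k} {n} {v} {p} eq =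
      contradiction correct (pageGuess-wrong x∈ p)

    correctSpine : Tuple q (suc k) → Fin (suc k)
    correctSpine x with Finₚ.any? (correct? x)
    ... | yes (i , _) = i
    -- Never reached on tuples of `L`, where some spine is correct.
    ... | no  _       = zero

    correctSpine-correct : ∀ {x} → x ∈ L → Correct x (correctSpine x)
    correctSpine-correct {x} x∈ with Finₚ.any? (correct? x)
    ... | yes (_ , correct) = correct
    ... | no  none          = contradiction (someSpineCorrect x∈) none

    -- Two tuples with the same label `i` and the same `π i` look alike to spine `i`. It makes one
    -- guess, correct for both, so their coordinates at `i` agree as well.
    winning⇒labellable : Labellable L
    winning⇒labellable = correctSpine , labelling λ {x} {y} x∈ y∈ gx≡gy eq →
      π-lookup-injective (correctSpine x) eq
        (trans (sym (correctSpine-correct x∈))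
          (trans (guess-cong _ _ _ (bookColoring-spine {x} {y} (correctSpine x) eq))
            (subst (Correct y) (sym gx≡gy) (correctSpine-correct y∈))))

winning⇒≤weight : ∀ {r k n q} (L : List (Tuple r (suc k))) → Obstruction L →
                  ∃ (Winning (book (suc k) n) q) → q ≤ weight L
-- Relabelling requires a nonempty color set, so `q = 0` is treated apart.
winning⇒≤weight {q = zero}  L obs _ = z≤n
winning⇒≤weight {k = k} {n} {q = suc j} L obs (S , wins) = ℕₚ.≮⇒≥ λ L<q →
  let L′ , (_ , proper , ¬lab) , L′≤L = obstruction-relabelled (suc j) L obs (ℕₚ.<⇒≤ L<q)
  in ¬lab (winning⇒labellable k n j S wins L′ proper (ℕₚ.≤-<-trans L′≤L L<q))

-- Two adjacent spines leave no proper coloring with a single color, so the win is vacuous.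
book-winning₁ : ∀ k n → ∃ (Winning (book (suc (suc k)) n) 1)
book-winning₁ k n = tableStrategy (book (suc (suc k)) n) 0 (λ _ → zero) ,
  λ c proper → contradiction (Fin1-irrelevant (c zero) (c (suc zero))) (proper zero (suc zero) _)
  where
  Fin1-irrelevant : (a b : Fin 1) → a ≡ b
  Fin1-irrelevant zero zero = refl

theorem1p4 : (k : ℕ) → 2 ≤ k →
    (m : Fin k → ℕ) (m≥2 : ∀ i → 2 ≤ m i) →
    sumOfReciprocals m m≥2 < 1ℚ →
    (∃[ c ] IsC k c × c ≤ product (tabulate m) + sum (tabulate m)) ×
    (∀ n → 1 ≤ n →
    ∃[ h ] IsHGP (book k n) h × h ≤ product (tabulate m) + sum (tabulate m))
theorem1p4 (suc (suc k)) (s≤s (s≤s _)) m m≥2 S<1 =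
  minimumWeight N {{ℕ.>-nonZero (ℕₚ.≤-trans (product-positive m m≥2) (ℕₚ.m≤m+n _ _))}}
    (box m) obs box≤N ,
  λ n _ → hgp-exists (book (suc (suc k)) n) N (book-winning₁ k n)
    λ q wins → ℕₚ.≤-trans (winning⇒≤weight (box m) obs wins) box≤N
  where
  N = product (tabulate m) + sum (tabulate m)

  obs : Obstruction (box m)
  obs = box-unique m , box-proper m , box-notLabellable m m≥2 S<1

  box≤N : weight (box m) ≤ N
  -- The support lies in the ambient color set, which has exactly `sum (tabulate m)` elements.
  box≤N = ℕₚ.+-mono-≤ (ℕₚ.≤-reflexive (length-box m)) (Subsetₚ.∣p∣≤n (support (box m)))
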